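{- The following are equivalent over $\mathsf{RCA}_0$. \begin{enumerate} \item $\mathsf{ACA}_0$. \item For every weak V-space $(X,\{\mathcal{W}_x : x \in X\})$, every set $Y$, every function $\pi : X \to Y$, and all $a,b \in X$: if $a$ and $b$ are connected in this V-space and $\pi(a) \neq \pi(b)$, then there exists an $x \in X$ such that $\pi$ is not constant on any vicinity $W \in \mathcal{W}_x$. \item For every strong V-space $(X,\{\mathcal{S}_x : x \in X\})$, every set $Y$, every function $\pi : X \to Y$, and all $a,b \in X$: if $a$ and $b$ are connected in this V-space and $\pi(a) \neq \pi(b)$, then there exists an $x \in X$ such that $\pi$ is not constant on any vicinity $S \in \mathcal{S}_x$. \end{enumerate}
   Context: $\mathsf{RCA}_0$ and $\mathsf{ACA}_0$ are the usual subsystems of second-order arithmetic (recursive comprehension and arithmetical comprehension). All notions below are formalized in the language of second-order arithmetic: $\omega$ denotes the set of natural numbers (of the model), all sets are subsets of it, and sequences of sets are coded by single sets in the usual way. Let $X$ be a non-empty subset of $\omega$. A weak system of vicinities for $x$ in $X$ is a sequence $\mathcal{W} = \langle W_n : n \in \omega\rangle$ such that $x \in W_n \subseteq X$ for all $n$. A weak V-space is a pair $(X,\{\mathcal{W}_x : x \in X\})$, where for each $x \in X$, $\mathcal{W}_x$ is a weak system of vicinities for $x$ in $X$ (the systems $\mathcal{W}_x$ being given together as a sequence indexed by $x \in X$). A strong system of vicinities for $x$ in $X$ is a sequence $\mathcal{S} = \langle S_n : n \in I\rangle$, where $I$ is a non-empty (possibly finite) initial segment of $\omega$, $x \in S_n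 \subseteq X$ for all $n \in I$, and $S_n \neq S_m$ for all $n,m \in I$ with $n \neq m$. A strong V-space is a pair $(X,\{\mathcal{S}_x : x \in X\})$, where for each $x \in X$, $\mathcal{S}_x$ is a strong system of vicinities for $x$ in $X$ (the systems $\mathcal{S}_x$, including their index sets, being given together as a sequence indexed by $x \in X$). In either case the members of the sequence $\mathcal{W}_x$ (respectively $\mathcal{S}_x$) are called the vicinities of $x$, and $W \in \mathcal{W}_x$ (respectively $S \in \mathcal{S}_x$) means that $W$ (respectively $S$) is a term of that sequence. A cover of a V-space is a sequence $\langle V_x : x \in X\rangle$ such that $V_x$ is a vicinity of $x$ for each $x \in X$. Two elements $a,b \in X$ are connected in the V-space if for every cover $\langle V_x : x \in X\rangle$ there is a finite sequence $x_0,\ldots,x_k$ of elements of $X$ such that $a = x_0$, $b = x_k$, and $V_{x_j} \cap V_{x_{j+1}} \neq \emptyset$ for each $j < k$. -}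

module Defs where

open import Level using (Level; _⊔_) renaming (suc to lsuc)
open import Data.Nat.Base using (ℕ; zero; suc)
open import Data.Fin.Base using (Fin; zero; suc)
open import Data.Vec.Base using (Vec; _∷_; lookup)
open import Data.Product.Base using (∃; _×_)
open import Data.Sum.Base using (_⊎_)
open import Data.Unit.Polymorphic.Base using (⊤)
open import Function.Bundles using (_⇔_)
open import Relation.Nullary.Negation.Core using (¬_; Stable)
open import Relation.Unary using (Pred; _⊆_; _≐_)
open import Relation.Binary.PropositionalEquality.Core using (_≡_; _≢_)

-- Second-order arithmetic is a classical theory, while the metatheory here is
-- constructive.  Every ∃ and ∨ of the object language is therefore read as its
-- double negation, and the atomic relations of a structure are required to be
-- stable (L₂-Structure below).  Then everything expressible in the language is
-- stable, classical logic is sound, and for a reader who accepts excluded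
-- middle this is ordinary Tarskian truth.

infixr 1 _⊎ᶜ_

∃ᶜ : ∀ {a b} {A : Set a} → (A → Set b) → Set (a ⊔ b)
∃ᶜ P = ¬ ¬ ∃ P

_⊎ᶜ_ : ∀ {a b} → Set a → Set b → Set (a ⊔ b)
A ⊎ᶜ B = ¬ ¬ (A ⊎ B)

------------------------------------------------------------------------
-- Syntax: k free number variables, m free set variables (de Bruijn, the
-- most recently bound variable of each sort is zero).

infixl 7 _`*_
infixl 6 _`+_
infix  5 _`≡_ _`<_ _`∈_
infix  4 `¬_
infixr 3 _`∧_
infixr 2 _`∨_
infixr 1 _`⇒_

data Term (k : ℕ) : Set where
  var       : Fin k → Term k
  `0 `1     : Term k
  _`+_ _`*_ : Term k → Term k → Term k

weaken : ∀ {k} → Term k → Term (suc k)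
weaken (var i)  = var (suc i)
weaken `0       = `0
weaken `1       = `1
weaken (s `+ t) = weaken s `+ weaken t
weaken (s `* t) = weaken s `* weaken t

data Formula (k m : ℕ) : Set where
  _`≡_ _`<_      : Term k → Term k → Formula k m
  _`∈_           : Term k → Fin m → Formula k m
  `¬_            : Formula k m → Formula k m
  _`∧_ _`∨_ _`⇒_ : Formula k m → Formula k m → Formula k m
  `∀ `∃          : Formula (suc k) m → Formula k m
  `∀² `∃²        : Formula k (suc m) → Formula k m

`∀<_∙_ `∃<_∙_ : ∀ {k m} → Term k → Formula (suc k) m → Formula k m
`∀< t ∙ φ = `∀ (var zero `< weaken t `⇒ φ)
`∃< t ∙ φ = `∃ (var zero `< weaken t `∧ φ)

data Δ₀ {k m : ℕ} : Formula k m → Set where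
  eq   : ∀ s t → Δ₀ (s `≡ t)
  lt   : ∀ s t → Δ₀ (s `< t)
  mem  : ∀ t X → Δ₀ (t `∈ X)
  neg  : ∀ {φ} → Δ₀ φ → Δ₀ (`¬ φ)
  conj : ∀ {φ ψ} → Δ₀ φ → Δ₀ ψ → Δ₀ (φ `∧ ψ)
  disj : ∀ {φ ψ} → Δ₀ φ → Δ₀ ψ → Δ₀ (φ `∨ ψ)
  imp  : ∀ {φ ψ} → Δ₀ φ → Δ₀ ψ → Δ₀ (φ `⇒ ψ)
  all< : ∀ t {φ} → Δ₀ φ → Δ₀ (`∀< t ∙ φ)
  ex<  : ∀ t {φ} → Δ₀ φ → Δ₀ (`∃< t ∙ φ)

data Σ⁰₁ {k m : ℕ} : Formula k m → Set where
  ex : ∀ {θ} → Δ₀ θ → Σ⁰₁ (`∃ θ)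

data Π⁰₁ {k m : ℕ} : Formula k m → Set where
  all : ∀ {θ} → Δ₀ θ → Π⁰₁ (`∀ θ)

data Arithmetical {k m : ℕ} : Formula k m → Set where
  eq   : ∀ s t → Arithmetical (s `≡ t)
  lt   : ∀ s t → Arithmetical (s `< t)
  mem  : ∀ t X → Arithmetical (t `∈ X)
  neg  : ∀ {φ} → Arithmetical φ → Arithmetical (`¬ φ)
  conj : ∀ {φ ψ} → Arithmetical φ → Arithmetical ψ → Arithmetical (φ `∧ ψ)
  disj : ∀ {φ ψ} → Arithmetical φ → Arithmetical ψ → Arithmetical (φ `∨ ψ)
  imp  : ∀ {φ ψ} → Arithmetical φ → Arithmetical ψ → Arithmetical (φ `⇒ ψ)
  all  : ∀ {φ} → Arithmetical φ → Arithmetical (`∀ φ)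
  ex   : ∀ {φ} → Arithmetical φ → Arithmetical (`∃ φ)

------------------------------------------------------------------------
-- Structures.  Sets are an arbitrary second sort with a membership relation;
-- the language has no equality between sets, so sets are compared
-- extensionally throughout.

record L₂-Structure (ℓ : Level) : Set (lsuc ℓ) where
  infixl 7 _*_
  infixl 6 _+_
  infix  4 _<_ _∈_
  field
    Num      : Set ℓ
    SetOf    : Set ℓ
    0# 1#    : Num
    _+_ _*_  : Num → Num → Num
    _<_      : Num → Num → Set ℓ
    _∈_      : Num → SetOf → Set ℓ
    ≡-stable : ∀ (x y : Num) → Stable (x ≡ y)
    <-stable : ∀ x y → Stable (x < y)
    ∈-stable : ∀ x X → Stable (x ∈ X)

module _ {ℓ : Level} (M : L₂-Structure ℓ) where
  open L₂-Structure M

  eval : ∀ {k} → Vec Num k → Term k → Num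
  eval ρ (var i)  = lookup ρ i
  eval ρ `0       = 0#
  eval ρ `1       = 1#
  eval ρ (s `+ t) = eval ρ s + eval ρ t
  eval ρ (s `* t) = eval ρ s * eval ρ t

  Sat : ∀ {k m} → Vec Num k → Vec SetOf m → Formula k m → Set ℓ
  Sat ρ σ (s `≡ t) = eval ρ s ≡ eval ρ t
  Sat ρ σ (s `< t) = eval ρ s < eval ρ t
  Sat ρ σ (t `∈ X) = eval ρ t ∈ lookup σ X
  Sat ρ σ (`¬ φ)   = ¬ Sat ρ σ φ
  Sat ρ σ (φ `∧ ψ) = Sat ρ σ φ × Sat ρ σ ψ
  Sat ρ σ (φ `∨ ψ) = Sat ρ σ φ ⊎ᶜ Sat ρ σ ψ
  Sat ρ σ (φ `⇒ ψ) = Sat ρ σ φ → Sat ρ σ ψ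
  Sat ρ σ (`∀ φ)   = ∀ x → Sat (x ∷ ρ) σ φ
  Sat ρ σ (`∃ φ)   = ∃ᶜ λ x → Sat (x ∷ ρ) σ φ
  Sat ρ σ (`∀² φ)  = ∀ X → Sat ρ (X ∷ σ) φ
  Sat ρ σ (`∃² φ)  = ∃ᶜ λ X → Sat ρ (X ∷ σ) φ

  record BasicAxioms : Set ℓ where
    field
      +1-nonzero   : ∀ n → n + 1# ≢ 0#
      +1-injective : ∀ m n → m + 1# ≡ n + 1# → m ≡ n
      +-zero       : ∀ m → m + 0# ≡ m
      +-suc        : ∀ m n → m + (n + 1#) ≡ (m + n) + 1#
      *-zero       : ∀ m → m * 0# ≡ 0#
      *-suc        : ∀ m n → m * (n + 1#) ≡ m * n + m
      ≮0           : ∀ m → ¬ (m < 0#)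
      <-suc        : ∀ m n → m < n + 1# ⇔ (m < n ⊎ᶜ m ≡ n)

  -- In the schemata, the bound variable is number variable zero, and ρ, σ
  -- assign the parameters.  The comprehended set is not among the m set
  -- variables, so it cannot occur in the formula.

  Σ⁰₁-Induction : Set ℓ
  Σ⁰₁-Induction =
    ∀ {k m} (φ : Formula (suc k) m) → Σ⁰₁ φ →
    ∀ (ρ : Vec Num k) (σ : Vec SetOf m) →
    Sat (0# ∷ ρ) σ φ →
    (∀ n → Sat (n ∷ ρ) σ φ → Sat (n + 1# ∷ ρ) σ φ) →
    ∀ n → Sat (n ∷ ρ) σ φ

  Δ⁰₁-Comprehension : Set ℓ
  Δ⁰₁-Comprehension =
    ∀ {k m} (φ ψ : Formula (suc k) m) → Σ⁰₁ φ → Π⁰₁ ψ →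
    ∀ (ρ : Vec Num k) (σ : Vec SetOf m) →
    (∀ n → Sat (n ∷ ρ) σ φ ⇔ Sat (n ∷ ρ) σ ψ) →
    ∃ᶜ λ X → ∀ n → n ∈ X ⇔ Sat (n ∷ ρ) σ φ

  SetInduction : Set ℓ
  SetInduction =
    ∀ X → 0# ∈ X → (∀ n → n ∈ X → n + 1# ∈ X) → ∀ n → n ∈ X

  ArithmeticalComprehension : Set ℓ
  ArithmeticalComprehension =
    ∀ {k m} (φ : Formula (suc k) m) → Arithmetical φ →
    ∀ (ρ : Vec Num k) (σ : Vec SetOf m) →
    ∃ᶜ λ X → ∀ n → n ∈ X ⇔ Sat (n ∷ ρ) σ φ

  record RCA₀ : Set ℓ where
    field
      basicAxioms       : BasicAxioms
      Σ⁰₁-induction     : Σ⁰₁-Induction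
      Δ⁰₁-comprehension : Δ⁰₁-Comprehension

  record ACA₀ : Set ℓ where
    field
      basicAxioms               : BasicAxioms
      setInduction              : SetInduction
      arithmeticalComprehension : ArithmeticalComprehension

------------------------------------------------------------------------
-- The notions below quantify only over the numbers and sets of M.

  ⟨_,_⟩ : Num → Num → Num
  ⟨ i , j ⟩ = (i + j) * (i + j) + i

  ⟦_⟧ : SetOf → Pred Num ℓ
  ⟦ X ⟧ n = n ∈ X

  -- The n-th term { i : ⟨ i , n ⟩ ∈ P } of the sequence coded by P.  A sequence
  -- indexed by the elements of X may have arbitrary columns outside X.
  column : Pred Num ℓ → Num → Pred Num ℓ
  column P n i = P ⟨ i , n ⟩

  -- f ⊆ X × Y is total on X and single-valued.
  record IsFunction (f X Y : SetOf) : Set ℓ where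
    field
      graph        : ∀ p → p ∈ f →
                     ∃ᶜ λ i → ∃ᶜ λ j → i ∈ X × j ∈ Y × p ≡ ⟨ i , j ⟩
      total        : ∀ i → i ∈ X → ∃ᶜ λ j → ⟨ i , j ⟩ ∈ f
      singleValued : ∀ i j j′ → ⟨ i , j ⟩ ∈ f → ⟨ i , j′ ⟩ ∈ f → j ≡ j′

  -- A finite sequence of length l is a finite (i.e. bounded) set of pairs that
  -- is the graph of a function with domain { i : i < l }.
  record IsFiniteSequence (s : SetOf) (l : Num) : Set ℓ where
    field
      finite       : ∃ᶜ λ b → ∀ p → p ∈ s → p < b
      pairs        : ∀ p → p ∈ s → ∃ᶜ λ i → ∃ᶜ λ j → p ≡ ⟨ i , j ⟩
      singleValued : ∀ i j j′ → ⟨ i , j ⟩ ∈ s → ⟨ i , j′ ⟩ ∈ s → j ≡ j′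
      domain       : ∀ i → i < l ⇔ (∃ᶜ λ j → ⟨ i , j ⟩ ∈ s)

  -- π(a) ≠ π(b)
  Separates : SetOf → Num → Num → Set ℓ
  Separates π a b = ∀ u v → ⟨ a , u ⟩ ∈ π → ⟨ b , v ⟩ ∈ π → u ≢ v

  ConstantOn : SetOf → Pred Num ℓ → Set ℓ
  ConstantOn π P =
    ∀ y z → P y → P z → ∀ u v → ⟨ y , u ⟩ ∈ π → ⟨ z , v ⟩ ∈ π → u ≡ v

  -- Notions common to weak and strong V-spaces: the vicinities of x ∈ X are the
  -- sets vicinity x n with Index x n.
  module Vicinities (X : SetOf) (Index : Num → Pred Num ℓ)
                    (vicinity : Num → Num → Pred Num ℓ) where

    IsCover : SetOf → Set ℓ
    IsCover V =
      ∀ x → x ∈ X → ∃ᶜ λ n → Index x n × column ⟦ V ⟧ x ≐ vicinity x n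

    -- s codes x₀, …, x_k.
    record IsChain (V : SetOf) (a b : Num) (s : SetOf) (k : Num) : Set ℓ where
      field
        sequence : IsFiniteSequence s (k + 1#)
        inX      : ∀ j x → ⟨ j , x ⟩ ∈ s → x ∈ X
        start    : ⟨ 0# , a ⟩ ∈ s
        end      : ⟨ k , b ⟩ ∈ s
        meets    : ∀ j → j < k → ∀ x y → ⟨ j , x ⟩ ∈ s → ⟨ j + 1# , y ⟩ ∈ s →
                   ∃ᶜ λ w → column ⟦ V ⟧ x w × column ⟦ V ⟧ y w

    Connected : Num → Num → Set ℓ
    Connected a b =
      ∀ V → IsCover V → ∃ᶜ λ s → ∃ᶜ λ k → IsChain V a b s k

    NonConstantPoint : SetOf → Set ℓ
    NonConstantPoint π =
      ∃ᶜ λ x → x ∈ X × (∀ n → Index x n → ¬ ConstantOn π (vicinity x n))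

    Principle : Set ℓ
    Principle =
      ∀ Y π a b → IsFunction π X Y → a ∈ X → b ∈ X →
      Connected a b → Separates π a b → NonConstantPoint π

  -- A sequence, indexed by x ∈ X, of sequences of sets: its x-th column is again
  -- a sequence, whose n-th column is the n-th vicinity of x.
  term : SetOf → Num → Num → Pred Num ℓ
  term W x n = column (column ⟦ W ⟧ x) n

  record IsWeakVSpace (X W : SetOf) : Set ℓ where
    field
      nonempty : ∃ᶜ λ x → x ∈ X
      centred  : ∀ x → x ∈ X → ∀ n → term W x n x
      inX      : ∀ x → x ∈ X → ∀ n → term W x n ⊆ ⟦ X ⟧

  -- I codes the sequence of index sets: column ⟦ I ⟧ x indexes the vicinities
  -- of x.
  record IsStrongVSpace (X I S : SetOf) : Set ℓ where
    field
      nonempty      : ∃ᶜ λ x → x ∈ X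
      indexNonempty : ∀ x → x ∈ X → ∃ᶜ λ n → column ⟦ I ⟧ x n
      indexInitial  : ∀ x → x ∈ X → ∀ m n → m < n →
                      column ⟦ I ⟧ x n → column ⟦ I ⟧ x m
      centred       : ∀ x → x ∈ X → ∀ n → column ⟦ I ⟧ x n → term S x n x
      inX           : ∀ x → x ∈ X → ∀ n → column ⟦ I ⟧ x n →
                      term S x n ⊆ ⟦ X ⟧
      distinct      : ∀ x → x ∈ X → ∀ n m →
                      column ⟦ I ⟧ x n → column ⟦ I ⟧ x m →
                      n ≢ m → ¬ (term S x n ≐ term S x m)

  WeakVSpacePrinciple : Set ℓ
  WeakVSpacePrinciple =
    ∀ X W → IsWeakVSpace X W →
    Vicinities.Principle X (λ _ _ → ⊤) (term W)

  StrongVSpacePrinciple : Set ℓ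
  StrongVSpacePrinciple =
    ∀ X I S → IsStrongVSpace X I S →
    Vicinities.Principle X (λ x → column ⟦ I ⟧ x) (term S)

{-# OPTIONS --safe #-}

-- From ACA₀, one can choose for each x the least vicinity on which π is constant.
-- If every x had one, these would form a cover, and π would be constant along
-- every chain for it, so that π(a) = π(b).
--
-- Conversely, let a set Z be given; it suffices to form its projection
-- { n : ∃ m. ⟨ m , n ⟩ ∈ Z }, for then, by induction on an arithmetical φ, the
-- codes of the tuples satisfying φ form a set.  Let T consist of the points ⟨ m + 2 , n ⟩ with
-- ⟨ m , n ⟩ ∈ Z, let π be 0 on T and 1 off T, let a ∈ T and b = ⟨ 1 , 0 ⟩ ∉ T.
-- The only vicinity of a point of T is T.  The m-th vicinity of x_n = ⟨ 0 , n ⟩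
-- contains b and all points ⟨ r , n ⟩ of T, unless ⟨ m , n ⟩ ∈ Z, in which case it
-- avoids them.  Then π is constant on some vicinity of each point, so by either
-- principle some cover V does not connect a with b.  If V_{x_n} contained b for
-- some n in the projection, then a, x_n, b would be a chain; hence the projection
-- is { n : b ∉ V_{x_n} }.  One further point ⟨ 0 , p + m + 1 ⟩ in the m-th vicinity
-- of each p ∉ T makes these vicinities distinct, so the space serves for both
-- principles.

module Submission where

open import Defs
open import Level using (Level)
open import Algebra.Bundles using (CommutativeSemiring)
import Algebra.Solver.Ring.NaturalCoefficients.Default as NaturalCoefficients
open import Algebra.Structures.Biased using (IsCommutativeSemiringˡ)
open import Data.Fin.Base using (zero; suc)
open import Data.Fin.Patterns
open import Data.Nat.Base using (suc)
open import Data.Product.Base using (∃; _×_; _,_; proj₁; proj₂)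
open import Data.Sum.Base as Sum using (_⊎_; inj₁; inj₂)
open import Data.Unit.Polymorphic.Base using (tt)
open import Data.Vec.Base using (Vec; []; _∷_; lookup)
open import Function.Base using (id; _∘_)
open import Function.Bundles using (_⇔_; mk⇔; Equivalence)
open import Function.Properties.Equivalence using () renaming (refl to ⇔-refl; trans to ⇔-trans)
open import Relation.Binary.PropositionalEquality
open import Relation.Nullary.Decidable.Core using (Dec; yes; no; ¬¬-excluded-middle)
open import Relation.Nullary.Negation
  using (¬_; Stable; ¬¬-map; negated-stable; contradiction)
open import Relation.Unary using (Pred; _≐_)

open Equivalence using (to; from)

-- Classical reasoning under double negation.

private
  variable
    a b : Level
    A B : Set a

pure : A → ¬ ¬ A
pure x k = k x

infixl 1 _>>=_

_>>=_ : ¬ ¬ A → (A → ¬ ¬ B) → ¬ ¬ B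
(m >>= f) k = m λ x → f x k

decide : (A : Set a) → ¬ ¬ Dec A
decide A = ¬¬-excluded-middle

×-stable : Stable A → Stable B → Stable (A × B)
×-stable s t m = s (¬¬-map proj₁ m) , t (¬¬-map proj₂ m)

→-stable : {A : Set a} {B : A → Set b} → (∀ x → Stable (B x)) → Stable (∀ x → B x)
→-stable s m x = s x (¬¬-map (λ f → f x) m)

⟪_,_⟫ : ∀ {k} → Term k → Term k → Term k
⟪ s , t ⟫ = (s `+ t) `* (s `+ t) `+ s

pattern v0 = var 0F
pattern v1 = var 1F
pattern v2 = var 2F
pattern v3 = var 3F
pattern v4 = var 4F
pattern v5 = var 5F
pattern v6 = var 6F

module Stability {ℓ} (M : L₂-Structure ℓ) where
  open L₂-Structure M

  -- Atoms are stable by assumption, `∃` and `∨` are already read as negations, and the other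
  -- connectives preserve stability. Hence satisfaction may be proved by classical case distinctions
  -- in the double-negation monad.
  Sat-stable : ∀ {k m} (φ : Formula k m) ρ σ → Stable (Sat M ρ σ φ)
  Sat-stable (s `≡ t) ρ σ = ≡-stable _ _
  Sat-stable (s `< t) ρ σ = <-stable _ _
  Sat-stable (t `∈ X) ρ σ = ∈-stable _ _
  Sat-stable (`¬ φ)   ρ σ = negated-stable
  Sat-stable (φ `∧ ψ) ρ σ = ×-stable (Sat-stable φ ρ σ) (Sat-stable ψ ρ σ)
  Sat-stable (φ `∨ ψ) ρ σ = negated-stable
  Sat-stable (φ `⇒ ψ) ρ σ = →-stable λ _ → Sat-stable ψ ρ σ
  Sat-stable (`∀ φ)   ρ σ = →-stable λ x → Sat-stable φ (x ∷ ρ) σ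
  Sat-stable (`∃ φ)   ρ σ = negated-stable
  Sat-stable (`∀² φ)  ρ σ = →-stable λ X → Sat-stable φ ρ (X ∷ σ)
  Sat-stable (`∃² φ)  ρ σ = negated-stable

-- Comprehension and induction for bounded formulas.

module Arithmetic {ℓ} (M : L₂-Structure ℓ) (rca : RCA₀ M) where
  open L₂-Structure M
  open Stability M
  open RCA₀ rca
  open BasicAxioms basicAxioms

  Set⟨_⟩ : Pred Num ℓ → Set ℓ
  Set⟨ P ⟩ = ∃ᶜ λ X → ∀ n → n ∈ X ⇔ P n

  -- Variable zero of θ stands for the unbounded quantifier that makes θ formally
  -- Σ⁰₁ or Π⁰₁.
  Δ₀-comprehension : ∀ {k m} {θ : Formula (suc (suc k)) m} → Δ₀ θ → ∀ ρ σ {P : Pred Num ℓ} →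
                     (∀ z n → Sat M (z ∷ n ∷ ρ) σ θ ⇔ P n) → Set⟨ P ⟩
  Δ₀-comprehension {θ = θ} d ρ σ {P} θ⇔P = do
    X , X⇔ ← Δ⁰₁-comprehension (`∃ θ) (`∀ θ) (ex d) (all d) ρ σ λ n →
      mk⇔ (λ e z → Sat-stable θ _ σ (¬¬-map (λ (z′ , s) → from (θ⇔P z n) (to (θ⇔P z′ n) s)) e))
          (λ f → pure (0# , f 0#))
    pure (X , λ n → mk⇔
      (λ n∈X → to (θ⇔P 0# n) (Sat-stable θ _ σ
        (¬¬-map (λ (z , s) → from (θ⇔P 0# n) (to (θ⇔P z n) s)) (to (X⇔ n) n∈X))))
      (λ p → from (X⇔ n) (pure (0# , from (θ⇔P 0# n) p))))

  -- A dummy existential quantifier over variable zero makes `θ` formally Σ⁰₁. The predicate `P` is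
  -- the meaning of `θ`, so base case and step can be argued without touching syntax.
  Δ₀-induction : ∀ {k m} {θ : Formula (suc (suc k)) m} → Δ₀ θ → ∀ ρ σ {P : Pred Num ℓ} →
                 (∀ z n → Sat M (z ∷ n ∷ ρ) σ θ ⇔ P n) →
                 P 0# → (∀ n → P n → P (n + 1#)) → ∀ n → P n
  Δ₀-induction {θ = θ} d ρ σ {P} θ⇔P p0 step n = elim n
    (Σ⁰₁-induction (`∃ θ) (ex d) ρ σ (intro 0# p0) (λ m s → intro _ (step m (elim m s))) n)
    where
    intro : ∀ m → P m → Sat M (m ∷ ρ) σ (`∃ θ)
    intro m p = pure (0# , from (θ⇔P 0# m) p)
    elim : ∀ m → Sat M (m ∷ ρ) σ (`∃ θ) → P m
    elim m s = to (θ⇔P 0# m) (Sat-stable θ _ σ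
      (¬¬-map (λ (z , s) → from (θ⇔P 0# m) (to (θ⇔P z m) s)) s))

  setInduction : SetInduction M
  setInduction X = Δ₀-induction (mem v1 0F) [] (X ∷ []) λ _ _ → ⇔-refl

  equationInduction : ∀ {k} (s t : Term (suc (suc k))) (ρ : Vec Num k) →
    let E = λ n → eval M (0# ∷ n ∷ ρ) s ≡ eval M (0# ∷ n ∷ ρ) t in
    (∀ z n → (eval M (z ∷ n ∷ ρ) s ≡ eval M (z ∷ n ∷ ρ) t) ⇔ E n) →
    E 0# → (∀ n → E n → E (n + 1#)) → ∀ n → E n
  equationInduction s t ρ = Δ₀-induction (eq s t) ρ []

  -- Semiring laws.

  +-identityˡ : ∀ n → 0# + n ≡ n
  +-identityˡ = equationInduction (`0 `+ v1) v1 [] (λ _ _ → ⇔-refl) (+-zero 0#)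
    λ n ih → trans (+-suc 0# n) (cong (_+ 1#) ih)

  +-sucˡ : ∀ m n → (m + 1#) + n ≡ (m + n) + 1#
  +-sucˡ m = equationInduction ((v2 `+ `1) `+ v1) ((v2 `+ v1) `+ `1) (m ∷ []) (λ _ _ → ⇔-refl)
    (trans (+-zero _) (cong (_+ 1#) (sym (+-zero m))))
    λ n ih → trans (+-suc _ n) (cong (_+ 1#) (trans ih (sym (+-suc m n))))

  +-comm : ∀ m n → m + n ≡ n + m
  +-comm m = equationInduction (v2 `+ v1) (v1 `+ v2) (m ∷ []) (λ _ _ → ⇔-refl)
    (trans (+-zero m) (sym (+-identityˡ m)))
    λ n ih → trans (+-suc m n) (trans (cong (_+ 1#) ih) (sym (+-sucˡ n m)))

  +-assoc : ∀ m n o → (m + n) + o ≡ m + (n + o)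
  +-assoc m n = equationInduction ((v2 `+ v3) `+ v1) (v2 `+ (v3 `+ v1)) (m ∷ n ∷ []) (λ _ _ → ⇔-refl)
    (trans (+-zero _) (cong (m +_) (sym (+-zero n))))
    λ o ih → trans (+-suc _ o) (trans (cong (_+ 1#) ih)
      (trans (sym (+-suc m _)) (cong (m +_) (sym (+-suc n o)))))

  +-exchange : ∀ m n o → (m + n) + o ≡ (m + o) + n
  +-exchange m n o = trans (+-assoc m n o) (trans (cong (m +_) (+-comm n o)) (sym (+-assoc m o n)))

  *-zeroˡ : ∀ n → 0# * n ≡ 0#
  *-zeroˡ = equationInduction (`0 `* v1) `0 [] (λ _ _ → ⇔-refl) (*-zero 0#)
    λ n ih → trans (*-suc 0# n) (trans (+-zero _) ih)

  *-sucˡ : ∀ m n → (m + 1#) * n ≡ m * n + n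
  *-sucˡ m = equationInduction ((v2 `+ `1) `* v1) (v2 `* v1 `+ v1) (m ∷ []) (λ _ _ → ⇔-refl)
    (trans (*-zero _) (sym (trans (+-zero _) (*-zero m))))
    λ n ih → begin
      (m + 1#) * (n + 1#)       ≡⟨ *-suc _ n ⟩
      (m + 1#) * n + (m + 1#)   ≡⟨ +-suc _ m ⟩
      ((m + 1#) * n + m) + 1#   ≡⟨ cong (λ x → (x + m) + 1#) ih ⟩
      ((m * n + n) + m) + 1#    ≡⟨ cong (_+ 1#) (+-exchange _ n m) ⟩
      ((m * n + m) + n) + 1#    ≡⟨ +-suc _ n ⟨
      (m * n + m) + (n + 1#)    ≡⟨ cong (_+ (n + 1#)) (*-suc m n) ⟨
      m * (n + 1#) + (n + 1#)   ∎
    where open ≡-Reasoning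

  *-comm : ∀ m n → m * n ≡ n * m
  *-comm m = equationInduction (v2 `* v1) (v1 `* v2) (m ∷ []) (λ _ _ → ⇔-refl)
    (trans (*-zero m) (sym (*-zeroˡ m)))
    λ n ih → trans (*-suc m n) (trans (cong (_+ m) ih) (sym (*-sucˡ n m)))

  *-distribˡ : ∀ m n o → m * (n + o) ≡ m * n + m * o
  *-distribˡ m n = equationInduction (v2 `* (v3 `+ v1)) (v2 `* v3 `+ v2 `* v1) (m ∷ n ∷ []) (λ _ _ → ⇔-refl)
    (trans (cong (m *_) (+-zero n)) (sym (trans (cong (m * n +_) (*-zero m)) (+-zero _))))
    λ o ih → begin
      m * (n + (o + 1#))      ≡⟨ cong (m *_) (+-suc n o) ⟩
      m * ((n + o) + 1#)      ≡⟨ *-suc m _ ⟩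
      m * (n + o) + m         ≡⟨ cong (_+ m) ih ⟩
      (m * n + m * o) + m     ≡⟨ +-assoc _ _ m ⟩
      m * n + (m * o + m)     ≡⟨ cong (m * n +_) (*-suc m o) ⟨
      m * n + m * (o + 1#)    ∎
    where open ≡-Reasoning

  *-distribʳ : ∀ m n o → (n + o) * m ≡ n * m + o * m
  *-distribʳ m n o = trans (*-comm _ m) (trans (*-distribˡ m n o) (cong₂ _+_ (*-comm m n) (*-comm m o)))

  *-assoc : ∀ m n o → (m * n) * o ≡ m * (n * o)
  *-assoc m n = equationInduction ((v2 `* v3) `* v1) (v2 `* (v3 `* v1)) (m ∷ n ∷ []) (λ _ _ → ⇔-refl)
    (trans (*-zero _) (sym (trans (cong (m *_) (*-zero n)) (*-zero m))))
    λ o ih → trans (*-suc _ o) (trans (cong (_+ m * n) ih)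
      (trans (sym (*-distribˡ m _ n)) (cong (m *_) (sym (*-suc n o)))))

  *-identityˡ : ∀ n → 1# * n ≡ n
  *-identityˡ n = trans (cong (_* n) (sym (+-identityˡ 1#)))
    (trans (*-sucˡ 0# n) (trans (cong (_+ n) (*-zeroˡ n)) (+-identityˡ n)))

  commutativeSemiring : CommutativeSemiring ℓ ℓ
  commutativeSemiring = record
    { isCommutativeSemiring = IsCommutativeSemiringˡ.isCommutativeSemiring record
      { +-isCommutativeMonoid = record
        { isMonoid = record
          { isSemigroup = record
            { isMagma = record { isEquivalence = isEquivalence ; ∙-cong = cong₂ _+_ }
            ; assoc   = +-assoc }
          ; identity = +-identityˡ , +-zero }
        ; comm = +-comm }
      ; *-isCommutativeMonoid = record
        { isMonoid = record
          { isSemigroup = record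
            { isMagma = record { isEquivalence = isEquivalence ; ∙-cong = cong₂ _*_ }
            ; assoc   = *-assoc }
          ; identity = *-identityˡ , λ n → trans (*-comm n 1#) (*-identityˡ n) }
        ; comm = *-comm }
      ; distribʳ = *-distribʳ
      ; zeroˡ    = *-zeroˡ }
    }

  open NaturalCoefficients commutativeSemiring using (solve; con; _:+_; _:*_; _:=_)

  -- Order and pairing.

  2# : Num
  2# = 1# + 1#

  pair : Num → Num → Num
  pair = ⟨_,_⟩ M

  +-cancelʳ : ∀ k {m n} → m + k ≡ n + k → m ≡ n
  +-cancelʳ k {m} {n} = Δ₀-induction {θ = v2 `+ v1 `≡ v3 `+ v1 `⇒ v2 `≡ v3} (imp (eq _ _) (eq _ _))
    (m ∷ n ∷ []) [] (λ _ _ → ⇔-refl)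
    (λ e → trans (sym (+-zero m)) (trans e (+-zero n)))
    (λ k ih e → ih (+1-injective _ _ (trans (sym (+-suc m k)) (trans e (+-suc n k)))))
    k

  -- The existential quantifier is moved in front of the disjunction to obtain a Σ⁰₁ induction
  -- formula; the induction step then ignores its hypothesis.
  zero-or-suc : ∀ n → n ≡ 0# ⊎ᶜ ∃ λ m → n ≡ m + 1#
  zero-or-suc n = do
    z , s ← Σ⁰₁-induction (`∃ (v1 `≡ `0 `∨ v1 `≡ v0 `+ `1)) (ex (disj (eq _ _) (eq _ _))) [] []
              (pure (0# , pure (inj₁ refl))) (λ m _ → pure (m , pure (inj₂ refl))) n
    ¬¬-map (λ { (inj₁ e) → inj₁ e ; (inj₂ e) → inj₂ (z , e) }) s

  -- Trichotomy in terms of addition, where the difference is the Σ⁰₁ witness. As `m` grows by one,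
  -- a positive difference `d` in the first case drops by one; at zero the second case takes over,
  -- and from then on `d` grows.
  compare-by-difference : ∀ m n → ∃ᶜ λ d → n ≡ m + d ⊎ᶜ m ≡ n + d + 1#
  compare-by-difference m n =
    Σ⁰₁-induction (`∃ (v2 `≡ v1 `+ v0 `∨ v1 `≡ v2 `+ v0 `+ `1)) (ex (disj (eq _ _) (eq _ _))) (n ∷ []) []
      (pure (n , pure (inj₁ (sym (+-identityˡ n))))) step m
    where
    step : ∀ m → ∃ᶜ (λ d → n ≡ m + d ⊎ᶜ m ≡ n + d + 1#) →
           ∃ᶜ λ d → n ≡ m + 1# + d ⊎ᶜ m + 1# ≡ n + d + 1#
    step m ih = do
      d , c ← ih
      inj₁ refl ← c
        where inj₂ refl → pure (d + 1# , pure (inj₂ (cong (_+ 1#) (+-assoc n d 1#))))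
      inj₁ refl ← zero-or-suc d
        where inj₂ (e , refl) → pure (e , pure (inj₁
                (solve 2 (λ m e → m :+ (e :+ con 1) := m :+ con 1 :+ e) refl m e)))
      pure (0# , pure (inj₂ (solve 1 (λ m → m :+ con 1 := m :+ con 0 :+ con 0 :+ con 1) refl m)))

  <-suc-of-< : ∀ {m n} → m < n → m < n + 1#
  <-suc-of-< m<n = from (<-suc _ _) (pure (inj₁ m<n))

  n<n+1 : ∀ n → n < n + 1#
  n<n+1 n = from (<-suc n n) (pure (inj₂ refl))

  m<m+d+1 : ∀ m d → m < m + d + 1#
  m<m+d+1 m = Δ₀-induction {θ = v2 `< v2 `+ v1 `+ `1} (lt _ _) (m ∷ []) [] (λ _ _ → ⇔-refl)
    (subst (λ x → m < x + 1#) (sym (+-zero m)) (n<n+1 m))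
    λ d ih → <-suc-of-< (subst (m <_) (+-assoc m d 1#) ih)

  <-by : ∀ {m n} d → n ≡ m + d + 1# → m < n
  <-by d refl = m<m+d+1 _ d

  compare : ∀ m n → ¬ ¬ (m < n ⊎ m ≡ n ⊎ n < m)
  compare m n = do
    d , c ← compare-by-difference m n
    inj₁ e ← c
      where inj₂ e → pure (inj₂ (inj₂ (<-by d e)))
    inj₂ (d , refl) ← zero-or-suc d
      where inj₁ refl → pure (inj₂ (inj₁ (sym (trans e (+-zero m)))))
    pure (inj₁ (<-by d (trans e (sym (+-assoc m d 1#)))))

  -- If i + j < i′ + j′ then (i + j)² + i < (i + j + 1)² ≤ (i′ + j′)²; here d is
  -- the difference i′ + j′ - (i + j) - 1.
  pair-sum : ∀ {i j i′ j′ d} → pair i j ≡ pair i′ j′ → i′ + j′ ≢ i + j + d + 1#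
  pair-sum {i} {j} {i′} {j′} {d} e e′ = +1-nonzero _ (sym (+-cancelʳ (pair i j) (begin
    0# + pair i j   ≡⟨ +-identityˡ _ ⟩
    pair i j        ≡⟨ e ⟩
    pair i′ j′      ≡⟨ cong (λ s → s * s + i′) e′ ⟩
    (i + j + d + 1#) * (i + j + d + 1#) + i′
      ≡⟨ solve 4 (λ i j d i′ →
           (i :+ j :+ d :+ con 1) :* (i :+ j :+ d :+ con 1) :+ i′ :=
           i :+ con 2 :* j :+ d :* d :+ con 2 :* d :+ con 2 :* (i :+ j) :* d :+ i′ :+ con 1
             :+ ((i :+ j) :* (i :+ j) :+ i))
           refl i j d i′ ⟩
    _ + 1# + pair i j ∎)))
    where open ≡-Reasoning

  -- By `pair-sum` neither of the sums `i + j` and `i′ + j′` exceeds the other, so they agree.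
  -- Cancelling the common square gives the first components, and the sums then give the second
  -- ones.
  pair-injective : ∀ {i j i′ j′} → pair i j ≡ pair i′ j′ → i ≡ i′ × j ≡ j′
  pair-injective {i} {j} {i′} {j′} e = i≡i′ , +-cancelʳ i (begin
    j + i    ≡⟨ +-comm j i ⟩
    i + j    ≡⟨ s≡s′ ⟩
    i′ + j′  ≡⟨ cong (_+ j′) i≡i′ ⟨
    i + j′   ≡⟨ +-comm i j′ ⟩
    j′ + i   ∎)
    where
    open ≡-Reasoning
    s≡s′ : i + j ≡ i′ + j′
    s≡s′ = ≡-stable _ _ do
      d , c ← compare-by-difference (i + j) (i′ + j′)
      inj₁ e₁ ← c
        where inj₂ e₂ → λ _ → pair-sum (sym e) e₂
      inj₂ (d′ , refl) ← zero-or-suc d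
        where inj₁ refl → pure (sym (trans e₁ (+-zero _)))
      λ _ → pair-sum e (trans e₁ (sym (+-assoc _ d′ 1#)))
    i≡i′ : i ≡ i′
    i≡i′ = +-cancelʳ ((i + j) * (i + j)) (begin
      i + (i + j) * (i + j)      ≡⟨ +-comm i _ ⟩
      pair i j                   ≡⟨ e ⟩
      pair i′ j′                 ≡⟨ cong (λ s → s * s + i′) s≡s′ ⟨
      (i + j) * (i + j) + i′     ≡⟨ +-comm _ i′ ⟩
      i′ + (i + j) * (i + j)     ∎)

  -- Bounds of this form keep quantifiers over the components of a coded pair bounded, so that
  -- decoding stays Δ₀.
  pair-boundˡ : ∀ i j → i < pair i j + 1#
  pair-boundˡ i j = <-by ((i + j) * (i + j)) (cong (_+ 1#) (+-comm _ i))

  pair-boundʳ : ∀ i j → j < pair i j + 1#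
  pair-boundʳ i j = <-stable _ _ do
    inj₂ (e , refl) ← zero-or-suc j
      where inj₁ refl → pure (<-by (pair i 0#) (cong (_+ 1#) (sym (+-identityˡ _))))
    -- The slack is `pair i j` minus `j`, with `j` equal to `e + 1#`, expanded so that no
    -- subtraction occurs.
    pure (<-by (e * e + i * i + i + e + i * e + i * e + i + i)
      (solve 2 (λ i e →
        (i :+ (e :+ con 1)) :* (i :+ (e :+ con 1)) :+ i :+ con 1 :=
        e :+ con 1 :+ (e :* e :+ i :* i :+ i :+ e :+ i :* e :+ i :* e :+ i :+ i) :+ con 1)
        refl i e))

  m≢m+d+1 : ∀ m d → m ≢ m + d + 1#
  m≢m+d+1 m d e = +1-nonzero d (sym (+-cancelʳ m (begin
    0# + m        ≡⟨ +-identityˡ m ⟩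
    m             ≡⟨ e ⟩
    m + d + 1#    ≡⟨ solve 2 (λ m d → m :+ d :+ con 1 := d :+ con 1 :+ m) refl m d ⟩
    d + 1# + m    ∎)))
    where open ≡-Reasoning

  -- Sets of pairs and sequences of sets.

  ∃ᶜ-map : {P Q : Num → Set ℓ} → (∀ x → P x → Q x) → ∃ᶜ P → ∃ᶜ Q
  ∃ᶜ-map f = ¬¬-map λ (x , p) → x , f x p

  record IsRelation (X : SetOf) (R : Num → Num → Set ℓ) : Set ℓ where
    field
      pairs : ∀ p → p ∈ X → ∃ᶜ λ x → ∃ᶜ λ y → p ≡ pair x y
      spec  : ∀ x y → pair x y ∈ X ⇔ R x y

  relation-comprehension :
    ∀ {k m} {θ : Formula (suc (suc (suc (suc k)))) m} → Δ₀ θ → ∀ ρ σ {R} →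
    (∀ x y z p → Sat M (y ∷ x ∷ z ∷ p ∷ ρ) σ θ ⇔ R x y) →
    ∃ᶜ λ X → IsRelation X R
  relation-comprehension {θ = θ} d ρ σ {R} θ⇔R = do
    X , X⇔ ← Δ₀-comprehension
      {θ = `∃< v1 `+ `1 ∙ (`∃< v2 `+ `1 ∙ (v3 `≡ ⟪ v1 , v0 ⟫ `∧ θ))}
      (ex< _ (ex< _ (conj (eq _ _) d))) ρ σ
      {λ p → ∃ᶜ λ x → x < p + 1# × ∃ᶜ λ y → y < p + 1# × p ≡ pair x y × R x y}
      (λ z p → mk⇔
        (∃ᶜ-map λ x (x< , e) → x< , ∃ᶜ-map (λ y (y< , p≡ , s) → y< , p≡ , to (θ⇔R x y z p) s) e)
        (∃ᶜ-map λ x (x< , e) → x< , ∃ᶜ-map (λ y (y< , p≡ , r) → y< , p≡ , from (θ⇔R x y z p) r) e))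
    pure (X , record
      { pairs = λ p p∈X →
          ∃ᶜ-map (λ x (_ , e) → ∃ᶜ-map (λ y (_ , p≡ , _) → p≡) e) (to (X⇔ p) p∈X)
      ; spec = λ x y → mk⇔
          (λ xy∈X → to (θ⇔R x y 0# 0#) (Sat-stable θ _ σ do
            x′ , _ , e ← to (X⇔ _) xy∈X
            y′ , _ , p≡ , r ← e
            let x≡ , y≡ = pair-injective p≡
            pure (from (θ⇔R x y 0# 0#) (subst₂ R (sym x≡) (sym y≡) r))))
          (λ r → from (X⇔ _) (pure (x , pair-boundˡ x y , pure (y , pair-boundʳ x y , refl , r)))) })

  -- Membership of `i` in the `n`-th term for `x` is membership of `pair (pair i n) x` in `W`. The
  -- outer pair is decoded by `relation-comprehension`, the inner one by a second pair of bounded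
  -- quantifiers.
  sequence-comprehension :
    ∀ {k m} {θ : Formula (suc (suc (suc (suc (suc (suc k)))))) m} → Δ₀ θ →
    ∀ ρ σ {R : Num → Num → Num → Set ℓ} →
    (∀ i n x u z p → Sat M (n ∷ i ∷ x ∷ u ∷ z ∷ p ∷ ρ) σ θ ⇔ R i n x) →
    ∃ᶜ λ W → ∀ i n x → term M W x n i ⇔ R i n x
  sequence-comprehension {θ = θ} d ρ σ {R} θ⇔R = do
    W , W-rel ← relation-comprehension
      {θ = `∃< v1 `+ `1 ∙ (`∃< v2 `+ `1 ∙ (v3 `≡ ⟪ v1 , v0 ⟫ `∧ θ))}
      (ex< _ (ex< _ (conj (eq _ _) d))) ρ σ
      {λ u x → ∃ᶜ λ i → i < u + 1# × ∃ᶜ λ n → n < u + 1# × u ≡ pair i n × R i n x}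
      (λ u x z p → mk⇔
        (∃ᶜ-map λ i (i< , e) → i< , ∃ᶜ-map (λ n (n< , u≡ , s) → n< , u≡ , to (θ⇔R i n x u z p) s) e)
        (∃ᶜ-map λ i (i< , e) → i< , ∃ᶜ-map (λ n (n< , u≡ , r) → n< , u≡ , from (θ⇔R i n x u z p) r) e))
    let open IsRelation W-rel
    pure (W , λ i n x → mk⇔
      (λ t → to (θ⇔R i n x 0# 0# 0#) (Sat-stable θ _ σ do
        i′ , _ , e ← to (spec _ _) t
        n′ , _ , u≡ , r ← e
        let i≡ , n≡ = pair-injective u≡
        pure (from (θ⇔R i n x 0# 0# 0#) (subst₂ (λ i n → R i n x) (sym i≡) (sym n≡) r))))
      (λ r → from (spec _ _) (pure (i , pair-boundˡ i n , pure (n , pair-boundʳ i n , refl , r)))))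

  -- Arithmetical comprehension from projections.

  Projection : Set ℓ
  Projection = ∀ Z → Set⟨ (λ c → ∃ᶜ λ y → pair y c ∈ Z) ⟩

  module _ (project : Projection) where

    -- The head is the first component of the outermost pair, so a projection eliminates exactly the
    -- most recently bound variable.
    code : ∀ {k} → Vec Num k → Num
    code []      = 0#
    code (x ∷ ρ) = pair x (code ρ)

    Graph : ∀ {k} → (Num → Vec Num k → Set ℓ) → Set ℓ
    Graph R = ∃ᶜ λ Z → ∀ v ρ → pair v (code ρ) ∈ Z ⇔ R v ρ

    -- x = f ρ and y = g ρ need not be bounded by v, so ⟨ x , y ⟩ is projected away
    -- instead.
    combine : ∀ {k} {f g : Vec Num k → Num} {ψ : Formula _ _} → Δ₀ ψ → {R : Num → Num → Num → Set ℓ} →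
      (∀ c v y x f e z p σ → Sat M (c ∷ v ∷ y ∷ x ∷ f ∷ e ∷ z ∷ p ∷ []) σ ψ ⇔ R v x y) →
      Graph (λ v ρ → v ≡ f ρ) → Graph (λ v ρ → v ≡ g ρ) →
      Graph (λ v ρ → R v (f ρ) (g ρ))
    combine {f = f} {g} {ψ} d {R} ψ⇔R F G = do
      F , F⇔ ← F
      G , G⇔ ← G
      D , D-rel ← relation-comprehension
        {θ = `∃< v1 `+ `1 ∙ (`∃< v2 `+ `1 ∙ (`∃< v2 `+ `1 ∙ (`∃< v3 `+ `1 ∙
               (v5 `≡ ⟪ v3 , v2 ⟫ `∧ v4 `≡ ⟪ v1 , v0 ⟫ `∧ ψ `∧ ⟪ v3 , v0 ⟫ `∈ 0F `∧ ⟪ v2 , v0 ⟫ `∈ 1F))))}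
        (ex< _ (ex< _ (ex< _ (ex< _ (conj (eq _ _) (conj (eq _ _) (conj d (conj (mem _ _) (mem _ _)))))))))
        [] (F ∷ G ∷ [])
        {λ e h → ∃ᶜ λ x → x < e + 1# × ∃ᶜ λ y → y < e + 1# × ∃ᶜ λ v → v < h + 1# × ∃ᶜ λ c → c < h + 1# ×
          e ≡ pair x y × h ≡ pair v c × R v x y × pair x c ∈ F × pair y c ∈ G}
        (λ e h z p → mk⇔
          (∃ᶜ-map λ x (x< , s) → x< , ∃ᶜ-map (λ y (y< , s) → y< , ∃ᶜ-map (λ v (v< , s) → v< , ∃ᶜ-map (λ c
            (c< , e≡ , h≡ , s , r) → c< , e≡ , h≡ , to (ψ⇔R _ _ _ _ _ _ _ _ _) s , r) s) s) s)
          (∃ᶜ-map λ x (x< , s) → x< , ∃ᶜ-map (λ y (y< , s) → y< , ∃ᶜ-map (λ v (v< , s) → v< , ∃ᶜ-map (λ c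
            (c< , e≡ , h≡ , s , r) → c< , e≡ , h≡ , from (ψ⇔R _ _ _ _ _ _ _ _ _) s , r) s) s) s))
      Z , Z⇔ ← project D
      let open IsRelation D-rel
      pure (Z , λ v ρ → mk⇔
        (λ v∈Z → to (ψ⇔R 0# v (g ρ) (f ρ) 0# 0# 0# 0# (F ∷ F ∷ [])) (Sat-stable ψ _ _ do
          e , e∈D ← to (Z⇔ _) v∈Z
          x , _ , s ← to (spec _ _) e∈D
          y , _ , s ← s
          v′ , _ , s ← s
          c , _ , e≡ , h≡ , r , x∈F , y∈G ← s
          let v≡ , c≡ = pair-injective h≡
              x≡ = to (F⇔ x ρ) (subst (λ c → pair x c ∈ F) (sym c≡) x∈F)
              y≡ = to (G⇔ y ρ) (subst (λ c → pair y c ∈ G) (sym c≡) y∈G)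
          pure (from (ψ⇔R _ _ _ _ _ _ _ _ _) (subst₂ (R v) x≡ y≡ (subst (λ v → R v x y) (sym v≡) r)))))
        (λ r → from (Z⇔ _) (pure (pair (f ρ) (g ρ) , from (spec _ _)
          (pure (_ , pair-boundˡ _ _ , pure (_ , pair-boundʳ _ _ ,
           pure (_ , pair-boundˡ _ _ , pure (_ , pair-boundʳ _ _ ,
           refl , refl , r , from (F⇔ _ ρ) refl , from (G⇔ _ ρ) refl)))))))))

    -- A tuple enters only through its code, so evaluating a term requires a set relating codes to
    -- values. Variables are found by peeling pairs off the code.
    term-graph : ∀ {k} (t : Term k) → Graph (λ v ρ → v ≡ eval M ρ t)
    term-graph (var zero) = do
      Z , Z-rel ← relation-comprehension {θ = `∃< v0 `+ `1 ∙ (v1 `≡ ⟪ v2 , v0 ⟫)} (ex< _ (eq _ _))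
        [] [] (λ _ _ _ _ → ⇔-refl)
      let open IsRelation Z-rel
      pure (Z , λ { v (x ∷ ρ) → mk⇔
        (λ v∈Z → ≡-stable _ _ do
          _ , _ , e ← to (spec _ _) v∈Z
          pure (sym (proj₁ (pair-injective e))))
        (λ { refl → from (spec _ _) (pure (_ , pair-boundʳ _ _ , refl)) }) })
    term-graph (var (suc i)) = do
      Y , Y⇔ ← term-graph (var i)
      Z , Z-rel ← relation-comprehension
        {θ = `∃< v0 `+ `1 ∙ (`∃< v1 `+ `1 ∙ (v2 `≡ ⟪ v1 , v0 ⟫ `∧ ⟪ v3 , v0 ⟫ `∈ 0F))}
        (ex< _ (ex< _ (conj (eq _ _) (mem _ _)))) [] (Y ∷ []) (λ _ _ _ _ → ⇔-refl)
      let open IsRelation Z-rel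
      pure (Z , λ { v (x ∷ ρ) → mk⇔
        (λ v∈Z → ≡-stable _ _ do
          _ , _ , s ← to (spec _ _) v∈Z
          c , _ , e , v∈Y ← s
          pure (to (Y⇔ v ρ) (subst (λ c → pair v c ∈ Y) (sym (proj₂ (pair-injective e))) v∈Y)))
        (λ e → from (spec _ _) (pure (_ , pair-boundˡ _ _ , pure (_ , pair-boundʳ _ _ , refl , from (Y⇔ v ρ) e)))) })
    term-graph `0 = do
      Z , Z-rel ← relation-comprehension {θ = v1 `≡ `0} (eq _ _) [] [] (λ _ _ _ _ → ⇔-refl)
      pure (Z , λ v ρ → IsRelation.spec Z-rel v _)
    term-graph `1 = do
      Z , Z-rel ← relation-comprehension {θ = v1 `≡ `1} (eq _ _) [] [] (λ _ _ _ _ → ⇔-refl)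
      pure (Z , λ v ρ → IsRelation.spec Z-rel v _)
    term-graph (s `+ t) = combine {f = λ ρ → eval M ρ s} {ψ = v1 `≡ v3 `+ v2} (eq _ _)
      (λ _ _ _ _ _ _ _ _ _ → ⇔-refl) (term-graph s) (term-graph t)
    term-graph (s `* t) = combine {f = λ ρ → eval M ρ s} {ψ = v1 `≡ v3 `* v2} (eq _ _)
      (λ _ _ _ _ _ _ _ _ _ → ⇔-refl) (term-graph s) (term-graph t)

    Coded : ∀ {k} → (Vec Num k → Set ℓ) → Set ℓ
    Coded P = ∃ᶜ λ Z → ∀ ρ → code ρ ∈ Z ⇔ P ρ

    coded-of-graph : ∀ {k} {P : Vec Num k → Set ℓ} → Graph (λ _ → P) → Coded P
    coded-of-graph G = do
      G , G⇔ ← G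
      -- The relation does not depend on the value, so its slice at zero suffices.
      Z , Z⇔ ← Δ₀-comprehension (mem ⟪ `0 , v1 ⟫ 0F) [] (G ∷ []) (λ _ _ → ⇔-refl)
      pure (Z , λ ρ → ⇔-trans (Z⇔ _) (G⇔ 0# ρ))

    coded-complement : ∀ {k} {P : Vec Num k → Set ℓ} → Coded P → Coded (λ ρ → ¬ P ρ)
    coded-complement C = do
      C , C⇔ ← C
      Z , Z⇔ ← Δ₀-comprehension (neg (mem v1 0F)) [] (C ∷ []) (λ _ _ → ⇔-refl)
      pure (Z , λ ρ → mk⇔ (λ c∈Z → to (Z⇔ _) c∈Z ∘ from (C⇔ ρ)) (λ ¬p → from (Z⇔ _) (¬p ∘ to (C⇔ ρ))))

    coded-∃ : ∀ {k} {P : Vec Num (suc k) → Set ℓ} → Coded P → Coded (λ ρ → ∃ᶜ λ x → P (x ∷ ρ))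
    coded-∃ C = do
      C , C⇔ ← C
      Z , Z⇔ ← project C
      pure (Z , λ ρ → mk⇔
        (λ c∈Z → ∃ᶜ-map (λ x → to (C⇔ (x ∷ ρ))) (to (Z⇔ _) c∈Z))
        (λ e → from (Z⇔ _) (∃ᶜ-map (λ x → from (C⇔ (x ∷ ρ))) e)))

    -- Terms in atoms are handled by their graphs, propositional connectives are Δ₀ in the sets
    -- already formed, and quantifiers are projections, with `∀` treated as not-exists-not.
    arithmetical-coded : ∀ {k m} {φ : Formula k m} → Arithmetical φ → ∀ σ → Coded (λ ρ → Sat M ρ σ φ)
    arithmetical-coded (eq s t) σ = coded-of-graph
      (combine {f = λ ρ → eval M ρ s} {ψ = v3 `≡ v2} (eq _ _)
        (λ _ _ _ _ _ _ _ _ _ → ⇔-refl) (term-graph s) (term-graph t))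
    arithmetical-coded (lt s t) σ = coded-of-graph
      (combine {f = λ ρ → eval M ρ s} {ψ = v3 `< v2} (lt _ _)
        (λ _ _ _ _ _ _ _ _ _ → ⇔-refl) (term-graph s) (term-graph t))
    arithmetical-coded (mem t X) σ = do
      G , G⇔ ← term-graph t
      D , D-rel ← relation-comprehension {θ = v1 `∈ 0F `∧ ⟪ v1 , v0 ⟫ `∈ 1F} (conj (mem _ _) (mem _ _))
        [] (lookup σ X ∷ G ∷ []) (λ _ _ _ _ → ⇔-refl)
      Z , Z⇔ ← project D
      let open IsRelation D-rel
      pure (Z , λ ρ → mk⇔
        (λ c∈Z → ∈-stable _ _ do
          v , v∈D ← to (Z⇔ _) c∈Z
          let v∈X , v∈G = to (spec _ _) v∈D
          pure (subst (_∈ _) (to (G⇔ v ρ) v∈G) v∈X))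
        (λ t∈X → from (Z⇔ _) (pure (_ , from (spec _ _) (t∈X , from (G⇔ _ ρ) refl)))))
    arithmetical-coded (neg a) σ = coded-complement (arithmetical-coded a σ)
    arithmetical-coded (conj a b) σ = do
      X , X⇔ ← arithmetical-coded a σ
      Y , Y⇔ ← arithmetical-coded b σ
      Z , Z⇔ ← Δ₀-comprehension (conj (mem v1 0F) (mem v1 1F)) [] (X ∷ Y ∷ []) (λ _ _ → ⇔-refl)
      pure (Z , λ ρ → mk⇔
        (λ c∈Z → let x , y = to (Z⇔ _) c∈Z in to (X⇔ ρ) x , to (Y⇔ ρ) y)
        (λ (x , y) → from (Z⇔ _) (from (X⇔ ρ) x , from (Y⇔ ρ) y)))
    arithmetical-coded (disj a b) σ = do
      X , X⇔ ← arithmetical-coded a σ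
      Y , Y⇔ ← arithmetical-coded b σ
      Z , Z⇔ ← Δ₀-comprehension (disj (mem v1 0F) (mem v1 1F)) [] (X ∷ Y ∷ []) (λ _ _ → ⇔-refl)
      pure (Z , λ ρ → mk⇔
        (λ c∈Z → ¬¬-map (Sum.map (to (X⇔ ρ)) (to (Y⇔ ρ))) (to (Z⇔ _) c∈Z))
        (λ s → from (Z⇔ _) (¬¬-map (Sum.map (from (X⇔ ρ)) (from (Y⇔ ρ))) s)))
    arithmetical-coded (imp a b) σ = do
      X , X⇔ ← arithmetical-coded a σ
      Y , Y⇔ ← arithmetical-coded b σ
      Z , Z⇔ ← Δ₀-comprehension (imp (mem v1 0F) (mem v1 1F)) [] (X ∷ Y ∷ []) (λ _ _ → ⇔-refl)
      pure (Z , λ ρ → mk⇔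
        (λ c∈Z → to (Y⇔ ρ) ∘ to (Z⇔ _) c∈Z ∘ from (X⇔ ρ))
        (λ f → from (Z⇔ _) (from (Y⇔ ρ) ∘ f ∘ to (X⇔ ρ))))
    arithmetical-coded {φ = `∀ φ} (all a) σ = do
      Z , Z⇔ ← coded-complement (coded-∃ (coded-complement (arithmetical-coded a σ)))
      pure (Z , λ ρ → mk⇔
        (λ c∈Z x → Sat-stable φ _ σ λ ¬s → to (Z⇔ ρ) c∈Z (pure (x , ¬s)))
        (λ f → from (Z⇔ ρ) λ e → e λ (x , ¬s) → ¬s (f x)))
    arithmetical-coded (ex a) σ = coded-∃ (arithmetical-coded a σ)

    ACA₀-of-projection : ACA₀ M
    ACA₀-of-projection = record
      { basicAxioms = basicAxioms
      ; setInduction = setInduction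
      ; arithmeticalComprehension = λ φ a ρ σ → do
          Z , Z⇔ ← arithmetical-coded a σ
          -- With the tail of the tuple fixed as the code of the parameters, the head is the
          -- comprehended variable.
          X , X⇔ ← Δ₀-comprehension (mem ⟪ v1 , v2 ⟫ 0F) (code ρ ∷ []) (Z ∷ []) (λ _ _ → ⇔-refl)
          pure (X , λ n → ⇔-trans (X⇔ n) (Z⇔ (n ∷ ρ)))
      }

  -- Least elements.

  <-suc-cancel : ∀ m n → m + 1# < n + 1# → m < n
  <-suc-cancel m = Δ₀-induction {θ = v2 `+ `1 `< v1 `+ `1 `⇒ v2 `< v1} (imp (lt _ _) (lt _ _)) (m ∷ []) []
    (λ _ _ → ⇔-refl)
    (λ h → <-stable _ _ λ _ → to (<-suc _ _) h λ { (inj₁ h) → ≮0 _ h ; (inj₂ e) → +1-nonzero m e })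
    (λ n ih h → <-stable _ _ (¬¬-map
      (λ { (inj₁ h) → <-suc-of-< (ih h) ; (inj₂ e) → subst (m <_) e (n<n+1 m) }) (to (<-suc _ _) h)))

  Least : (Num → Set ℓ) → Num → Set ℓ
  Least P n = P n × (∀ m → m < n → ¬ P m)

  least-unique : ∀ {P m n} → Least P m → Least P n → m ≡ n
  least-unique {m = m} {n} (p , p-min) (q , q-min) = ≡-stable m n do
    inj₂ (inj₁ e) ← compare m n
      where inj₁ h → contradiction p (q-min _ h)
            inj₂ (inj₂ h) → contradiction q (p-min _ h)
    pure e

  -- If there were no least element, induction on `n` would show that no number below `n` qualifies,
  -- contradicting the given one.
  least-exists : ∀ G x → ∃ᶜ (λ n → pair n x ∈ G) → ∃ᶜ (Least (λ n → pair n x ∈ G))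
  least-exists G x e none = e λ (n , n∈G) → below (n + 1#) n (n<n+1 n) n∈G
    where
    below : ∀ n m → m < n → ¬ (pair m x ∈ G)
    below = Δ₀-induction {θ = `∀< v1 ∙ (`¬ ⟪ v0 , v3 ⟫ `∈ 0F)} (all< _ (neg (mem _ _))) (x ∷ []) (G ∷ [])
      (λ _ _ → ⇔-refl)
      (λ m m<0 _ → ≮0 m m<0)
      (λ n ih m m<n+1 m∈G → to (<-suc m n) m<n+1
        λ { (inj₁ h) → ih m h m∈G ; (inj₂ refl) → none (n , m∈G , ih) })

  -- Both principles from arithmetical comprehension.

  module _ (aca : ACA₀ M) where

    arithmeticalComprehension : ArithmeticalComprehension M
    arithmeticalComprehension = ACA₀.arithmeticalComprehension aca

    -- Unbounded quantifiers are available for decoding here. Numbers that are not pairs enter the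
    -- set vacuously, which is harmless because only pairs are tested.
    arithmetical-relation :
      ∀ {k m} {θ : Formula (suc (suc (suc k))) m} → Arithmetical θ → ∀ ρ σ {R : Num → Num → Set ℓ} →
      (∀ x y p → Sat M (y ∷ x ∷ p ∷ ρ) σ θ ⇔ R x y) →
      ∃ᶜ λ X → ∀ x y → pair x y ∈ X ⇔ R x y
    arithmetical-relation {θ = θ} d ρ σ {R} θ⇔R = do
      X , X⇔ ← arithmeticalComprehension (`∀ (`∀ (v2 `≡ ⟪ v1 , v0 ⟫ `⇒ θ))) (all (all (imp (eq _ _) d))) ρ σ
      pure (X , λ x y → mk⇔
        (λ xy∈X → to (θ⇔R x y _) (to (X⇔ _) xy∈X x y refl))
        (λ r → from (X⇔ _) λ x′ y′ e → let x≡ , y≡ = pair-injective e in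
          from (θ⇔R x′ y′ _) (subst₂ R x≡ y≡ r)))

    -- Weak and strong spaces differ here only in their index relation; a set `I` representing it
    -- makes the argument uniform.
    principle-of-ACA₀ : ∀ X W I (Index : Num → Pred Num ℓ) →
      (∀ x n → Index x n ⇔ pair n x ∈ I) →
      (∀ x → x ∈ X → ∀ n → Index x n → term M W x n x) →
      (∀ x → x ∈ X → ∀ n → Index x n → ∀ i → term M W x n i → i ∈ X) →
      Vicinities.Principle M X Index (term M W)
    principle-of-ACA₀ X W I Index Index⇔I centred inX
      -- The conclusion is a double negation: `allConstant` refutes its inner existential, and the
      -- block derives a doubly negated contradiction, discharged by `id`.
      Y π a b function a∈X b∈X connected separates allConstant = (do
      G , G⇔ ← arithmetical-relation
        {θ = ⟪ v1 , v0 ⟫ `∈ 0F `∧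
             `∀ (`∀ (⟪ ⟪ v1 , v3 ⟫ , v2 ⟫ `∈ 1F `⇒ ⟪ ⟪ v0 , v3 ⟫ , v2 ⟫ `∈ 1F `⇒
                     `∀ (`∀ (⟪ v3 , v1 ⟫ `∈ 2F `⇒ ⟪ v2 , v0 ⟫ `∈ 2F `⇒ v1 `≡ v0))))}
        (conj (mem _ _) (all (all (imp (mem _ _) (imp (mem _ _)
          (all (all (imp (mem _ _) (imp (mem _ _) (eq _ _))))))))))
        [] (I ∷ W ∷ π ∷ []) {λ n x → pair n x ∈ I × ConstantOn M π (term M W x n)}
        (λ _ _ _ → ⇔-refl)
      -- The vicinity is described through every least index; as that index exists and is unique,
      -- this is the vicinity it selects.
      V , V⇔ ← arithmetical-relation
        {θ = `∀ (⟪ v0 , v1 ⟫ `∈ 0F `∧ `∀ (v0 `< v1 `⇒ `¬ ⟪ v0 , v2 ⟫ `∈ 0F) `⇒ ⟪ ⟪ v2 , v0 ⟫ , v1 ⟫ `∈ 1F)}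
        (all (imp (conj (mem _ _) (all (imp (lt _ _) (neg (mem _ _))))) (mem _ _)))
        [] (G ∷ W ∷ []) {λ i x → ∀ n → Least (λ n → pair n x ∈ G) n → term M W x n i}
        (λ _ _ _ → ⇔-refl)
      let least : ∀ x → x ∈ X → ∃ᶜ (Least (λ n → pair n x ∈ G))
          least x x∈X = least-exists G x λ none → allConstant
            (x , x∈X , λ n idx const → none (n , from (G⇔ n x) (to (Index⇔I x n) idx , const)))
          V-is : ∀ {x n} → Least (λ n → pair n x ∈ G) n → column M (⟦_⟧ M V) x ≐ term M W x n
          V-is l = (λ v → to (V⇔ _ _) v _ l) ,
                   (λ {i} t → from (V⇔ _ _) λ n′ l′ → subst (λ n → term M W _ n i) (least-unique l l′) t)
      s , chains ← connected V λ x x∈X → ∃ᶜ-map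
        (λ n l → from (Index⇔I x n) (proj₁ (to (G⇔ n x) (proj₁ l))) , V-is l) (least x x∈X)
      k , chain ← chains
      let open Vicinities.IsChain chain renaming (inX to s⊆X)
          open IsFiniteSequence sequence
          open IsFunction function using (total)
      -- For `j` up to `k`, membership in `J` says that `π` takes the same value at the `j`-th point
      -- as at `a`. Set induction on `J` thus carries this value along the chain.
      J , J⇔ ← arithmeticalComprehension
        (v0 `< v1 `+ `1 `⇒ `∀ (`∀ (⟪ v2 , v1 ⟫ `∈ 0F `⇒ ⟪ v1 , v0 ⟫ `∈ 1F `⇒ ⟪ v4 , v0 ⟫ `∈ 1F)))
        (imp (lt _ _) (all (all (imp (mem _ _) (imp (mem _ _) (mem _ _))))))
        (k ∷ a ∷ []) (s ∷ π ∷ [])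
      let step : ∀ j → j ∈ J → j + 1# ∈ J
          step j j∈J = from (J⇔ _) λ j+1<k+1 y u y∈s yu∈π → ∈-stable _ _ do
            let j<k = <-suc-cancel j k j+1<k+1
                y∈X = s⊆X _ y y∈s
            x , x∈s ← to (domain j) (<-suc-of-< j<k)
            let x∈X = s⊆X j x x∈s
            -- Both vicinities are centred and `π` is constant on each, so its value at the common
            -- point `w` is its value at `x` and at `y`.
            w , w∈x , w∈y ← meets j j<k x y x∈s y∈s
            n , l ← least x x∈X
            n′ , l′ ← least y y∈X
            let idx , const = to (G⇔ n x) (proj₁ l)
                idx′ , const′ = to (G⇔ n′ y) (proj₁ l′)
                w∈Wx = proj₁ (V-is l) w∈x
                w∈Wy = proj₁ (V-is l′) w∈y
            v , wv∈π ← total w (inX x x∈X n (from (Index⇔I x n) idx) w w∈Wx)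
            v′ , xv′∈π ← total x x∈X
            let v′≡v = const x w (centred x x∈X n (from (Index⇔I x n) idx)) w∈Wx v′ v xv′∈π wv∈π
                u≡v  = const′ y w (centred y y∈X n′ (from (Index⇔I y n′) idx′)) w∈Wy u v yu∈π wv∈π
            pure (to (J⇔ j) j∈J (<-suc-of-< j<k) x u x∈s
              (subst (λ v → pair x v ∈ π) (trans v′≡v (sym u≡v)) xv′∈π))
          J-all = setInduction J
            (from (J⇔ 0#) λ _ x u x∈s xu∈π → subst (λ x → pair x u ∈ π) (singleValued 0# x a x∈s start) xu∈π)
            step
      v , bv∈π ← total b b∈X
      pure (separates v v (to (J⇔ k) (J-all k) (n<n+1 k) b v end bv∈π) bv∈π refl)) id

    weakPrinciple-of-ACA₀ : WeakVSpacePrinciple M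
    weakPrinciple-of-ACA₀ X W weak Y π a b function a∈X b∈X connected separates k = (do
      I , I⇔ ← Δ₀-comprehension (eq v1 v1) [] [] (λ _ _ → ⇔-refl)
      pure (principle-of-ACA₀ X W I _ (λ x n → mk⇔ (λ _ → from (I⇔ _) refl) (λ _ → tt))
        (λ x x∈X n _ → centred x x∈X n) (λ x x∈X n _ i → inX x x∈X n)
        Y π a b function a∈X b∈X connected separates k)) id
      where open IsWeakVSpace weak

    strongPrinciple-of-ACA₀ : StrongVSpacePrinciple M
    strongPrinciple-of-ACA₀ X I S strong = principle-of-ACA₀ X S I _ (λ _ _ → ⇔-refl)
      centred (λ x x∈X n idx i → inX x x∈X n idx)
      where open IsStrongVSpace strong

  -- Chains of three points.

  0≢1 : 0# ≢ 1#
  0≢1 e = +1-nonzero 0# (trans (+-identityˡ 1#) (sym e))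

  suc≢0 : ∀ {m n} → n ≡ m + 1# → n ≢ 0#
  suc≢0 e e′ = +1-nonzero _ (trans (sym e) e′)

  <2 : ∀ {j} → j < 2# → j ≡ 0# ⊎ᶜ j ≡ 1#
  <2 j<2 = to (<-suc _ _) j<2 >>= λ
    { (inj₂ e) → pure (inj₂ e)
    ; (inj₁ j<1) → to (<-suc _ 0#) (subst (_ <_) (sym (+-identityˡ 1#)) j<1) >>= λ
        { (inj₂ e) → pure (inj₁ e) ; (inj₁ j<0) → contradiction j<0 (≮0 _) } }

  0<1 : 0# < 1#
  0<1 = subst (0# <_) (+-identityˡ 1#) (n<n+1 0#)

  Triple : Num → Num → Num → Num → Num → Set ℓ
  Triple x y z j w = (j ≡ 0# × w ≡ x) ⊎ᶜ (j ≡ 1# × w ≡ y) ⊎ᶜ (j ≡ 2# × w ≡ z)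

  triple : ∀ x y z → ∃ᶜ λ s → IsFiniteSequence M s (2# + 1#) × (∀ j w → pair j w ∈ s ⇔ Triple x y z j w)
  triple x y z = do
    s , s-rel ← relation-comprehension
      {θ = (v1 `≡ `0 `∧ v0 `≡ v4) `∨ (v1 `≡ `1 `∧ v0 `≡ v5) `∨ (v1 `≡ `1 `+ `1 `∧ v0 `≡ v6)}
      (disj (conj (eq _ _) (eq _ _)) (disj (conj (eq _ _) (eq _ _)) (conj (eq _ _) (eq _ _))))
      (x ∷ y ∷ z ∷ []) [] {Triple x y z} (λ _ _ _ _ → ⇔-refl)
    let open IsRelation s-rel
        p = pair 0# x
        q = pair 1# y
        r = pair 2# z
    pure (s , record
      -- The sum of the three pair codes, plus one, exceeds each of them.
      { finite = pure (p + q + r + 1# , λ e e∈s → <-stable _ _ do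
          j , f ← pairs e e∈s
          w , e≡ ← f
          t ← to (spec j w) (subst (_∈ s) e≡ e∈s)
          inj₂ t ← pure t
            where inj₁ (j≡ , w≡) → pure (<-by (q + r) (trans (cong (_+ 1#) (+-assoc p q r))
                    (cong (λ e → e + (q + r) + 1#) (sym (trans e≡ (cong₂ pair j≡ w≡))))))
          inj₂ (j≡ , w≡) ← t
            where inj₁ (j≡ , w≡) → pure (<-by (p + r) (trans (cong (_+ 1#)
                    (solve 3 (λ p q r → p :+ q :+ r := q :+ (p :+ r)) refl p q r))
                    (cong (λ e → e + (p + r) + 1#) (sym (trans e≡ (cong₂ pair j≡ w≡))))))
          pure (<-by (p + q) (trans (cong (_+ 1#) (+-comm (p + q) r))
            (cong (λ e → e + (p + q) + 1#) (sym (trans e≡ (cong₂ pair j≡ w≡)))))))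
      ; pairs = pairs
      ; singleValued = λ j w w′ jw∈s jw′∈s → ≡-stable _ _ do
          t ← to (spec j w) jw∈s
          t′ ← to (spec j w′) jw′∈s
          unique t t′
      ; domain = λ j → mk⇔
          (λ j<3 → to (<-suc j 2#) j<3 >>= λ
            { (inj₂ e) → pure (z , from (spec j z) (pure (inj₂ (pure (inj₂ (e , refl))))))
            ; (inj₁ j<2) → <2 j<2 >>= λ
              { (inj₁ e) → pure (x , from (spec j x) (pure (inj₁ (e , refl))))
              ; (inj₂ e) → pure (y , from (spec j y) (pure (inj₂ (pure (inj₁ (e , refl)))))) } })
          (λ e → <-stable _ _ do
            w , jw∈s ← e
            inj₂ t ← to (spec j w) jw∈s
              where inj₁ (refl , _) → pure (<-suc-of-< (<-suc-of-< 0<1))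
            inj₂ (refl , _) ← t
              where inj₁ (refl , _) → pure (<-suc-of-< (n<n+1 1#))
            pure (n<n+1 2#))
      } , spec)
    where
    1≢2 : 1# ≢ 2#
    1≢2 e = 0≢1 (+1-injective 0# 1# (trans (+-identityˡ 1#) e))
    unique : ∀ {j w w′} → (j ≡ 0# × w ≡ x) ⊎ ((j ≡ 1# × w ≡ y) ⊎ᶜ (j ≡ 2# × w ≡ z)) →
             (j ≡ 0# × w′ ≡ x) ⊎ ((j ≡ 1# × w′ ≡ y) ⊎ᶜ (j ≡ 2# × w′ ≡ z)) → ¬ ¬ (w ≡ w′)
    unique (inj₁ (_ , refl)) (inj₁ (_ , refl)) = pure refl
    unique (inj₁ (refl , _)) (inj₂ t) = t >>= λ
      { (inj₁ (e , _)) → contradiction e 0≢1 ; (inj₂ (e , _)) → contradiction (sym e) (suc≢0 refl) }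
    unique (inj₂ t) (inj₁ (refl , _)) = t >>= λ
      { (inj₁ (e , _)) → contradiction e 0≢1 ; (inj₂ (e , _)) → contradiction (sym e) (suc≢0 refl) }
    unique (inj₂ t) (inj₂ t′) = t >>= λ
      { (inj₁ (refl , refl)) → t′ >>= λ { (inj₁ (_ , refl)) → pure refl ; (inj₂ (e , _)) → contradiction e 1≢2 }
      ; (inj₂ (refl , refl)) → t′ >>= λ { (inj₂ (_ , refl)) → pure refl ; (inj₁ (e , _)) → contradiction (sym e) 1≢2 } }

  -- The space built from a set of witnesses.

  pivot : Num
  pivot = pair 1# 0#

  -- The first coordinate is at least two, which keeps witnesses apart from the points `pair 0# n`
  -- and from the pivot.
  witness : Num → Num → Num
  witness m n = pair (m + 1# + 1#) n

  -- These points are distinct for distinct `m` and differ from `p`; their first coordinate 0 keeps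
  -- them off `T`, so adding them does not disturb constancy of `π`.
  fresh : Num → Num → Num
  fresh p m = pair 0# (p + m + 1#)

  -- The m-th vicinity of pair 0 n takes in the pivot and the witnesses for n
  -- unless m itself gives a witness for n.
  Link : SetOf → Num → Num → Num → Set ℓ
  Link T i m p = ∃ᶜ λ n → n < p + 1# × p ≡ pair 0# n × ¬ (witness m n ∈ T) ×
                 (i ≡ pivot ⊎ᶜ i ∈ T × ∃ᶜ λ r → r < i + 1# × i ≡ pair r n)

  -- All terms at a point of `T` coincide with `T`, so for the strong space `I` grants such a point
  -- the single index 0, while every other point keeps all indices.
  record Space (T U W π I : SetOf) : Set ℓ where
    field
      T-witness : ∀ p → p ∈ T → ∃ᶜ λ m → ∃ᶜ λ n → p ≡ witness m n
      U-all     : ∀ n → n ∈ U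
      W-spec    : ∀ i m p → term M W p m i ⇔
                  ((p ∈ T → i ∈ T) × (¬ (p ∈ T) → i ≡ p ⊎ᶜ i ≡ fresh p m ⊎ᶜ Link T i m p))
      π-rel     : IsRelation π (λ p c → (p ∈ T → c ≡ 0#) × (¬ (p ∈ T) → c ≡ 1#))
      I-spec    : ∀ m p → pair m p ∈ I ⇔ (p ∈ T → m ≡ 0#)

  space : ∀ T → (∀ p → p ∈ T → ∃ᶜ λ m → ∃ᶜ λ n → p ≡ witness m n) →
          ∃ᶜ λ ((U , W , π , I) : SetOf × SetOf × SetOf × SetOf) → Space T U W π I
  space T T-witness = do
    U , U⇔ ← Δ₀-comprehension (eq v1 v1) [] [] (λ _ _ → ⇔-refl)
    W , W⇔ ← sequence-comprehension
      {θ = (v2 `∈ 0F `⇒ v1 `∈ 0F) `∧ (`¬ v2 `∈ 0F `⇒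
             v1 `≡ v2 `∨ v1 `≡ ⟪ `0 , v2 `+ v0 `+ `1 ⟫ `∨
             (`∃< v2 `+ `1 ∙ (v3 `≡ ⟪ `0 , v0 ⟫ `∧ `¬ (⟪ v1 `+ `1 `+ `1 , v0 ⟫ `∈ 0F) `∧
               (v2 `≡ ⟪ `1 , `0 ⟫ `∨ v2 `∈ 0F `∧ (`∃< v2 `+ `1 ∙ (v3 `≡ ⟪ v0 , v1 ⟫))))))}
      (conj (imp (mem _ _) (mem _ _)) (imp (neg (mem _ _)) (disj (eq _ _) (disj (eq _ _)
        (ex< _ (conj (eq _ _) (conj (neg (mem _ _)) (disj (eq _ _) (conj (mem _ _) (ex< _ (eq _ _)))))))))))
      [] (T ∷ []) (λ _ _ _ _ _ _ → ⇔-refl)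
    π , π-rel ← relation-comprehension
      {θ = (v1 `∈ 0F `⇒ v0 `≡ `0) `∧ (`¬ v1 `∈ 0F `⇒ v0 `≡ `1)}
      (conj (imp (mem _ _) (eq _ _)) (imp (neg (mem _ _)) (eq _ _)))
      [] (T ∷ []) (λ _ _ _ _ → ⇔-refl)
    I , I-rel ← relation-comprehension {θ = v0 `∈ 0F `⇒ v1 `≡ `0} (imp (mem _ _) (eq _ _))
      [] (T ∷ []) (λ _ _ _ _ → ⇔-refl)
    pure ((U , W , π , I) , record
      { T-witness = T-witness ; U-all = λ n → from (U⇔ n) refl ; W-spec = W⇔ ; π-rel = π-rel
      ; I-spec = IsRelation.spec I-rel })

  module SpaceProperties {T U W π I : SetOf} (S : Space T U W π I) where
    open Space S
    open IsRelation π-rel renaming (pairs to π-pairs; spec to π-spec)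

    pair0∉T : ∀ n → ¬ (pair 0# n ∈ T)
    pair0∉T n h = T-witness _ h λ (m , e) → e λ (n′ , e) → +1-nonzero _ (sym (proj₁ (pair-injective e)))

    pivot∉T : ¬ (pivot ∈ T)
    pivot∉T h = T-witness _ h λ (m , e) → e λ (n′ , e) →
      +1-nonzero m (sym (+1-injective 0# (m + 1#) (trans (+-identityˡ 1#) (proj₁ (pair-injective e)))))

    fresh≢ : ∀ p m → fresh p m ≢ p
    fresh≢ p m e = m≢m+d+1 p (p * p + m * m + p * m + p * m + p + m + m) (trans (sym e)
      (solve 2 (λ p m → (con 0 :+ (p :+ m :+ con 1)) :* (con 0 :+ (p :+ m :+ con 1)) :+ con 0 :=
        p :+ (p :* p :+ m :* m :+ p :* m :+ p :* m :+ p :+ m :+ m) :+ con 1) refl p m))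

    centred : ∀ p m → term M W p m p
    centred p m = from (W-spec p m p) (id , λ _ → pure (inj₁ refl))

    fresh-vicinity : ∀ {p} m → ¬ (p ∈ T) → term M W p m (fresh p m)
    fresh-vicinity m p∉T = from (W-spec _ m _)
      ((λ p∈T → contradiction p∈T p∉T) , λ _ → pure (inj₂ (pure (inj₁ refl))))

    π-function : IsFunction M π U U
    π-function = record
      { graph = λ p p∈π → ∃ᶜ-map (λ i → ∃ᶜ-map λ j e → U-all i , U-all j , e) (π-pairs p p∈π)
      ; total = λ i _ → decide (i ∈ T) >>= λ
          { (yes h) → pure (0# , from (π-spec _ _) ((λ _ → refl) , λ ¬h → contradiction h ¬h))
          ; (no ¬h) → pure (1# , from (π-spec _ _) ((λ h → contradiction h ¬h) , λ _ → refl)) }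
      ; singleValued = λ i j j′ h h′ → ≡-stable _ _ (decide (i ∈ T) >>= λ
          { (yes i∈T) → pure (trans (proj₁ (to (π-spec i j) h) i∈T) (sym (proj₁ (to (π-spec i j′) h′) i∈T)))
          ; (no i∉T) → pure (trans (proj₂ (to (π-spec i j) h) i∉T) (sym (proj₂ (to (π-spec i j′) h′) i∉T))) })
      }

    separates : ∀ {a} → a ∈ T → Separates M π a pivot
    separates a∈T u v au∈π bv∈π u≡v = 0≢1 (trans (sym (proj₁ (to (π-spec _ _) au∈π) a∈T))
      (trans u≡v (proj₂ (to (π-spec _ _) bv∈π) pivot∉T)))

    constant-outside : ∀ {p m} → (∀ i → term M W p m i → ¬ (i ∈ T)) → ConstantOn M π (term M W p m)
    constant-outside out y z y∈ z∈ u v yu zv =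
      trans (proj₂ (to (π-spec _ _) yu) (out y y∈)) (sym (proj₂ (to (π-spec _ _) zv) (out z z∈)))

    -- Besides links, the vicinity holds only `p` itself and a fresh point, and neither lies in `T`.
    outside : ∀ {p m} → ¬ (p ∈ T) → (∀ i → Link T i m p → ¬ (i ∈ T)) → ∀ i → term M W p m i → ¬ (i ∈ T)
    outside p∉T linked i t i∈T = proj₂ (to (W-spec _ _ _) t) p∉T λ
      { (inj₁ refl) → p∉T i∈T
      ; (inj₂ c) → c λ { (inj₁ refl) → pair0∉T _ i∈T ; (inj₂ l) → linked i l i∈T } }

    -- At a point of `T` the vicinity is `T`. At `pair 0# n` with a witness for `n`, the index given
    -- by that witness switches the link off. At any other point no element of `T` is linked, so
    -- index 0 serves.
    constant-vicinity : ∀ p → ∃ᶜ λ m → (p ∈ T → m ≡ 0#) × ConstantOn M π (term M W p m)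
    constant-vicinity p = decide (p ∈ T) >>= λ
      { (yes p∈T) → pure (0# , (λ _ → refl) , λ y z y∈ z∈ u v yu zv →
          trans (proj₁ (to (π-spec _ _) yu) (proj₁ (to (W-spec _ _ _) y∈) p∈T))
                (sym (proj₁ (to (π-spec _ _) zv) (proj₁ (to (W-spec _ _ _) z∈) p∈T))))
      ; (no p∉T) → decide (∃ λ n → ∃ λ m → p ≡ pair 0# n × witness m n ∈ T) >>= λ
        { (yes (n , m , p≡ , w∈T)) → pure (m , (λ p∈T → contradiction p∈T p∉T) ,
            constant-outside (outside p∉T λ i l i∈T → l λ (n′ , _ , p≡′ , w∉T , _) →
              w∉T (subst (λ n → witness m n ∈ T) (proj₂ (pair-injective (trans (sym p≡) p≡′))) w∈T)))
        ; (no none) → pure (0# , (λ _ → refl) , constant-outside (outside p∉T λ i l i∈T →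
            l λ (n , _ , p≡ , _ , c) → c λ
              { (inj₁ refl) → pivot∉T i∈T
              ; (inj₂ (_ , e)) → e λ (r , _ , i≡) → T-witness i i∈T λ (m , e′) → e′ λ (n′ , i≡′) →
                  none (n , m , p≡ , subst (_∈ T)
                    (trans i≡′ (cong (witness m) (proj₂ (pair-injective (trans (sym i≡′) i≡))))) i∈T) })) } }

    -- Recovering the projection from either principle.

    module _ (Index : Num → Pred Num ℓ) (index : ∀ {p m} → (p ∈ T → m ≡ 0#) → Index p m)
             (principle : Vicinities.Principle M U Index (term M W)) where
      open Vicinities M U Index (term M W)

      connected-absurd : ∀ {a} → a ∈ T → ¬ Connected a pivot
      connected-absurd a∈T connected =
        principle U π _ pivot π-function (U-all _) (U-all _) connected (separates a∈T) λ (p , _ , nonconstant) →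
          constant-vicinity p λ (m , p∈T→m≡0 , const) → nonconstant m (index p∈T→m≡0) const

      -- The chain is `a`, `pair 0# n`, `pivot`. A link that admits the pivot also admits every
      -- witness for `n` in `T`, so the middle vicinity meets that of `a`, which is `T`; it meets
      -- the last one in the pivot.
      chain : ∀ {a n m V} → a ∈ T → IsCover V → column M (⟦_⟧ M V) (pair 0# n) pivot → witness m n ∈ T →
              ∃ᶜ λ s → ∃ᶜ λ k → IsChain V a pivot s k
      chain {a} {n} {m} {V} a∈T cover pivot∈ w∈T = do
        _ , _ , Va ← cover a (U-all a)
        m′ , _ , Vx ← cover x (U-all x)
        _ , _ , Vb ← cover pivot (U-all pivot)
        s , sequence , spec ← triple a x pivot
        c ← proj₂ (to (W-spec _ _ _) (proj₁ Vx pivot∈)) (pair0∉T n)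
        inj₂ c ← pure c
          where inj₁ e → contradiction (sym (proj₁ (pair-injective e))) 0≢1
        inj₂ l ← c
          where inj₁ e → contradiction (sym (proj₁ (pair-injective e))) 0≢1
        n′ , n′< , x≡ , w∉T , _ ← l
        let n≡n′ = proj₂ (pair-injective x≡)
            w∈Va = proj₂ Va (from (W-spec (witness m n) _ a) ((λ _ → w∈T) , λ a∉T → contradiction a∈T a∉T))
            w∈Vx = proj₂ Vx (from (W-spec (witness m n) m′ x) ((λ h → contradiction h (pair0∉T n)) , λ _ →
              pure (inj₂ (pure (inj₂ (pure (n′ , n′< , x≡ , w∉T , pure (inj₂ (w∈T ,
                pure (_ , pair-boundˡ _ _ , cong (witness m) n≡n′))))))))))
            b∈Vb = proj₂ Vb (centred pivot _)
            at : ∀ {j w} → pair j w ∈ s → ∀ {w′} → pair j w′ ∈ s → w ≡ w′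
            at h h′ = IsFiniteSequence.singleValued sequence _ _ _ h h′
            start = from (spec 0# a) (pure (inj₁ (refl , refl)))
            mid   = from (spec 1# x) (pure (inj₂ (pure (inj₁ (refl , refl)))))
            end   = from (spec 2# pivot) (pure (inj₂ (pure (inj₂ (refl , refl)))))
        pure (s , pure (2# , record
          { sequence = sequence
          ; inX   = λ _ _ _ → U-all _
          ; start = start
          ; end   = end
          ; meets = λ j j<2 y z y∈s z∈s → <2 j<2 >>= λ
              { (inj₁ refl) → subst₂ Meets (at start y∈s)
                  (at mid (subst (λ j → pair j z ∈ s) (+-identityˡ 1#) z∈s)) (pure (_ , w∈Va , w∈Vx))
              ; (inj₂ refl) → subst₂ Meets (at mid y∈s) (at end z∈s) (pure (_ , pivot∈ , b∈Vb)) }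
          }))
        where
        x : Num
        x = pair 0# n
        Meets : Num → Num → Set ℓ
        Meets y z = ∃ᶜ λ w → column M (⟦_⟧ M V) y w × column M (⟦_⟧ M V) z w

      -- A cover that fails to connect a to the pivot puts the pivot in the vicinity
      -- of pair 0 n exactly when n has no witness.
      witnessed-set : ∀ {a} → a ∈ T → Set⟨ (λ n → ∃ᶜ λ m → witness m n ∈ T) ⟩
      witnessed-set a∈T none = connected-absurd a∈T λ V cover no-chain → (do
        A , A⇔ ← Δ₀-comprehension (neg (mem ⟪ ⟪ `1 , `0 ⟫ , ⟪ `0 , v1 ⟫ ⟫ 0F)) [] (V ∷ []) (λ _ _ → ⇔-refl)
        contradiction (A , λ n → mk⇔
          (λ n∈A → do
            m , _ , _ , Vx⊇ ← cover (pair 0# n) (U-all _)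
            pure (m , ∈-stable _ _ λ w∉T → to (A⇔ n) n∈A (Vx⊇ (from (W-spec _ _ _)
              ((λ h → contradiction h (pair0∉T n)) , λ _ → pure (inj₂ (pure (inj₂
                (pure (n , pair-boundʳ _ _ , refl , w∉T , pure (inj₁ refl)))))))))))
          (λ e → from (A⇔ n) λ pivot∈ → e λ (m , w∈T) → chain a∈T cover pivot∈ w∈T no-chain)) none) id

    weak-space : IsWeakVSpace M U W
    weak-space = record
      { nonempty = pure (0# , U-all 0#) ; centred = λ p _ m → centred p m ; inX = λ _ _ _ _ → U-all _ }

    strong-space : IsStrongVSpace M U I W
    strong-space = record
      { nonempty      = pure (0# , U-all 0#)
      ; indexNonempty = λ p _ → pure (0# , from (I-spec 0# p) λ _ → refl)
      ; indexInitial  = λ p _ m n m<n n∈I → from (I-spec m p) λ p∈T →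
          contradiction (subst (m <_) (to (I-spec n p) n∈I p∈T) m<n) (≮0 m)
      ; centred       = λ p _ m _ → centred p m
      ; inX           = λ _ _ _ _ _ → U-all _
      ; distinct      = λ p _ n m n∈I m∈I n≢m (n⊆m , _) → decide (p ∈ T) λ
          { (yes p∈T) → n≢m (trans (to (I-spec n p) n∈I p∈T) (sym (to (I-spec m p) m∈I p∈T)))
          -- If the two terms agreed, `fresh p n` would lie in term `m`. It is not `p`, and its
          -- first coordinate 0 excludes a link, so it equals `fresh p m`, which forces `n` to equal
          -- `m`.
          ; (no p∉T) → proj₂ (to (W-spec _ _ _) (n⊆m (fresh-vicinity n p∉T))) p∉T λ
            { (inj₁ e) → fresh≢ p n e
            ; (inj₂ c) → c λ
              { (inj₁ e) → n≢m (+-cancelʳ p (trans (+-comm n p) (trans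
                  (+1-injective _ _ (proj₂ (pair-injective e))) (+-comm p m))))
              ; (inj₂ l) → l λ (_ , _ , _ , _ , c) → c λ
                { (inj₁ e) → 0≢1 (proj₁ (pair-injective e)) ; (inj₂ (h , _)) → pair0∉T _ h } } } }
      }

  projection-of-witnessed : (∀ {T U W π I a} → Space T U W π I → a ∈ T → Set⟨ (λ n → ∃ᶜ λ m → witness m n ∈ T) ⟩) →
                  Projection
  projection-of-witnessed witnessed Z = do
    T , T-rel ← relation-comprehension
      {θ = `∃< v1 `+ `1 ∙ (v2 `≡ v0 `+ `1 `+ `1 `∧ ⟪ v0 , v1 ⟫ `∈ 0F)}
      (ex< _ (conj (eq _ _) (mem _ _))) [] (Z ∷ []) (λ _ _ _ _ → ⇔-refl)
    let open IsRelation T-rel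
        T-witness : ∀ p → p ∈ T → ∃ᶜ λ m → ∃ᶜ λ n → p ≡ witness m n
        T-witness p p∈T = do
          k , e ← pairs p p∈T
          n , p≡ ← e
          m , _ , k≡ , _ ← to (spec k n) (subst (_∈ T) p≡ p∈T)
          pure (m , pure (n , trans p≡ (cong (λ k → pair k n) k≡)))
        w⇔ : ∀ m n → witness m n ∈ T ⇔ pair m n ∈ Z
        w⇔ m n = mk⇔
          (λ w∈T → ∈-stable _ _ do
            m′ , _ , m≡ , h ← to (spec _ _) w∈T
            pure (subst (λ m → pair m n ∈ Z) (sym (+1-injective _ _ (+1-injective _ _ m≡))) h))
          (λ h → from (spec _ _) (pure (m , <-by 2# (cong (_+ 1#) (+-assoc m 1# 1#)) , refl , h)))
    -- The argument needs a point of `T`. If there is none, `Z` contains no pair, and the empty set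
    -- `T` is itself the projection.
    yes (a , a∈T) ← decide (∃ (_∈ T))
      where no empty → pure (T , λ n → mk⇔ (λ n∈T → contradiction (n , n∈T) empty)
                         (λ e → ∈-stable _ _ λ _ → e λ (m , h) → empty (_ , from (w⇔ m n) h)))
    _ , S ← space T T-witness
    A , A⇔ ← witnessed S a∈T
    pure (A , λ n → mk⇔ (λ n∈A → ∃ᶜ-map (λ m → to (w⇔ m n)) (to (A⇔ n) n∈A))
                        (λ e → from (A⇔ n) (∃ᶜ-map (λ m → from (w⇔ m n)) e)))

  ACA₀-of-weakPrinciple : WeakVSpacePrinciple M → ACA₀ M
  ACA₀-of-weakPrinciple principle = ACA₀-of-projection (projection-of-witnessed λ {_} {U} {W} S →
    let open SpaceProperties S in witnessed-set _ (λ _ → tt) (principle U W weak-space))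

  ACA₀-of-strongPrinciple : StrongVSpacePrinciple M → ACA₀ M
  ACA₀-of-strongPrinciple principle = ACA₀-of-projection (projection-of-witnessed λ {_} {U} {W} {_} {I} S →
    let open SpaceProperties S in
    witnessed-set _ (λ {p} {m} → from (Space.I-spec S m p)) (principle U I W strong-space))

theorem2p4 : ∀ {ℓ} (M : L₂-Structure ℓ) → RCA₀ M →
    (ACA₀ M ⇔ WeakVSpacePrinciple M) × (ACA₀ M ⇔ StrongVSpacePrinciple M)
theorem2p4 M rca = mk⇔ weakPrinciple-of-ACA₀ ACA₀-of-weakPrinciple ,
                   mk⇔ strongPrinciple-of-ACA₀ ACA₀-of-strongPrinciple
  where open Arithmetic M rca
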